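{- For all $P,Q\in C_A$, $\mathrm{CP}\vdash P=Q$ if and only if $P=_{se}Q$, i.e. if and only if $se(P)=se(Q)$.
   Context: Let $A$ be a countable set (of atoms) with at least two elements. $C_A$ is the set of closed terms (conditional statements) over the signature with constants $T$, $F$, a constant $a$ for each $a\in A$, and one ternary operation $x\triangleleft y\triangleright z$ (the conditional, "if $y$ then $x$ else $z$"). $\mathrm{CP}$ is the set of equational axioms (in variables $x,y,z,u,v$): (CP1) $x\triangleleft T\triangleright y=x$; (CP2) $x\triangleleft F\triangleright y=y$; (CP3) $T\triangleleft x\triangleright F=x$; (CP4) $x\triangleleft(y\triangleleft z\triangleright u)\triangleright v=(x\triangleleft y\triangleright v)\triangleleft z\triangleright(x\triangleleft u\triangleright v)$. For a set $E$ of equational axioms, $E\vdash s=t$ means derivability in equational logic from $E$. Evaluation trees: the set $\mathcal T_A$ is defined inductively by $T\in\mathcal T_A$, $F\in\mathcal T_A$, and $(X\trianglelefteq a\trianglerighteq Y)\in\mathcal T_A$ for all $X,Y\in\mathcal T_A$, $a\in A$ (binary tree with root $a$, left branch $X$, right branch $Y$). Leaf replacement: for $Y,Z\in\mathcal T_A$, $X[T\mapsto Y,F\mapsto Z]$ is defined by $T[T\mapsto Y,F\mapsto Z]=Y$, $F[T\mapsto Y,F\mapsto Z]=Z$, $(X_1\trianglelefteq a\trianglerighteq X_2)[T\mapsto Y,F\mapsto Z]=X_1[T\mapsto Y,F\mapsto Z]\trianglelefteq a\trianglerighteq X_2[T\mapsto Y,F\mapsto Z]$. The short-circuit evaluation function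 $se:C_A\to\mathcal T_A$ is defined by $se(T)=T$, $se(F)=F$, $se(a)=T\trianglelefteq a\trianglerighteq F$ for $a\in A$, and $se(P\triangleleft Q\triangleright R)=se(Q)[T\mapsto se(P),F\mapsto se(R)]$. Free valuation congruence on $C_A$: $P=_{se}Q$ iff $se(P)=se(Q)$. -}

module Defs where

open import Data.Empty using (⊥; ⊥-elim)
open import Data.Nat using (ℕ)
open import Level using (Level; _⊔_)
open import Relation.Binary.Core using (Rel)
open import Relation.Binary.PropositionalEquality using (_≡_)

private
  variable
    a b c e : Level
    A : Set a
    V : Set b
    W : Set c

infix 8 _◁_▷_ _⊴_⊵_
infixl 9 _⟪_⟫
infix 9 _[T↦_,F↦_]
infix 4 _=se_ _⊢_≈_ _⊢_≈ᶜ_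

-- In  x ◁ y ▷ z  the condition is the middle argument: if y then x else z.
data Term (A : Set a) (V : Set b) : Set (a ⊔ b) where
  var   : V → Term A V
  T F   : Term A V
  atom  : A → Term A V
  _◁_▷_ : Term A V → Term A V → Term A V → Term A V

C : Set a → Set a
C A = Term A ⊥

_⟪_⟫ : Term A V → (V → Term A W) → Term A W
var x ⟪ σ ⟫       = σ x
T ⟪ σ ⟫           = T
F ⟪ σ ⟫           = F
atom α ⟪ σ ⟫      = atom α
(p ◁ q ▷ r) ⟪ σ ⟫ = (p ⟪ σ ⟫) ◁ (q ⟪ σ ⟫) ▷ (r ⟪ σ ⟫)

⌜_⌝ : C A → Term A ℕ
⌜ P ⌝ = P ⟪ ⊥-elim ⟫

-- Equational logic over a set E of axioms: s ≈ t is an axiom when E s t is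
-- inhabited. Variables are natural numbers, and derivations may pass through
-- open terms.
data _⊢_≈_ {A : Set a} (E : Rel (Term A ℕ) e) : Rel (Term A ℕ) (a ⊔ e) where
  axiom        : ∀ {s t} → E s t → E ⊢ s ≈ t
  reflexivity  : ∀ {s} → E ⊢ s ≈ s
  symmetry     : ∀ {s t} → E ⊢ s ≈ t → E ⊢ t ≈ s
  transitivity : ∀ {s t u} → E ⊢ s ≈ t → E ⊢ t ≈ u → E ⊢ s ≈ u
  congruence   : ∀ {s s′ t t′ u u′} → E ⊢ s ≈ s′ → E ⊢ t ≈ t′ → E ⊢ u ≈ u′ →
                 E ⊢ s ◁ t ▷ u ≈ s′ ◁ t′ ▷ u′
  substitution : ∀ {s t} (σ : ℕ → Term A ℕ) → E ⊢ s ≈ t → E ⊢ s ⟪ σ ⟫ ≈ t ⟪ σ ⟫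

_⊢_≈ᶜ_ : {A : Set a} → Rel (Term A ℕ) e → Rel (C A) (a ⊔ e)
E ⊢ P ≈ᶜ Q = E ⊢ ⌜ P ⌝ ≈ ⌜ Q ⌝

module _ {A : Set a} where

  private
    x y z u v : Term A ℕ
    x = var 0
    y = var 1
    z = var 2
    u = var 3
    v = var 4

  data CP : Rel (Term A ℕ) a where
    CP1 : CP (x ◁ T ▷ y) x
    CP2 : CP (x ◁ F ▷ y) y
    CP3 : CP (T ◁ x ▷ F) x
    CP4 : CP (x ◁ (y ◁ z ▷ u) ▷ v) ((x ◁ y ▷ v) ◁ z ▷ (x ◁ u ▷ v))

data Tree (A : Set a) : Set a where
  T F   : Tree A
  _⊴_⊵_ : Tree A → A → Tree A → Tree A

_[T↦_,F↦_] : Tree A → Tree A → Tree A → Tree A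
T [T↦ Y ,F↦ Z ]             = Y
F [T↦ Y ,F↦ Z ]             = Z
(X₁ ⊴ α ⊵ X₂) [T↦ Y ,F↦ Z ] = (X₁ [T↦ Y ,F↦ Z ]) ⊴ α ⊵ (X₂ [T↦ Y ,F↦ Z ])

se : C A → Tree A
se T           = T
se F           = F
se (atom α)    = T ⊴ α ⊵ F
se (P ◁ Q ▷ R) = se Q [T↦ se P ,F↦ se R ]

_=se_ : {A : Set a} → Rel (C A) a
P =se Q = se P ≡ se Q

{-# OPTIONS --safe #-}
-- Soundness: evaluation trees form a model of CP in which the conditional is
-- leaf replacement; valuing the variables by trees extends se to open terms, and
-- the extension validates each rule of equational logic. Completeness: reading a
-- tree as a nested conditional over atoms gives a normal form, and CP proves
-- every closed term equal to the normal form read off its evaluation tree.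
module Submission where

open import Defs
open import Data.Nat using (ℕ; suc)
open import Data.Product using (∃₂)
open import Function.Base using (_∘_)
open import Function.Bundles using (_↣_; _⇔_; mk⇔)
open import Relation.Binary.PropositionalEquality
  using (_≡_; _≢_; refl; sym; trans; cong; cong₂; module ≡-Reasoning)

module _ {ℓ} {A : Set ℓ} where

  -- The tree form of CP3.
  [T↦T,F↦F]-identity : ∀ (X : Tree A) → X [T↦ T ,F↦ F ] ≡ X
  [T↦T,F↦F]-identity T           = refl
  [T↦T,F↦F]-identity F           = refl
  [T↦T,F↦F]-identity (X ⊴ α ⊵ Y) =
    cong₂ (_⊴ α ⊵_) ([T↦T,F↦F]-identity X) ([T↦T,F↦F]-identity Y)

  -- Leaf replacement is a bind over two kinds of leaf: the outer replacement meets only leaves of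
  -- the grafted copies of `Y` and `Z`. This is CP4 in the tree model.
  [T↦,F↦]-assoc : ∀ (X Y Z U V : Tree A) →
    (X [T↦ Y ,F↦ Z ]) [T↦ U ,F↦ V ] ≡
    X [T↦ Y [T↦ U ,F↦ V ] ,F↦ Z [T↦ U ,F↦ V ] ]
  [T↦,F↦]-assoc T             Y Z U V = refl
  [T↦,F↦]-assoc F             Y Z U V = refl
  [T↦,F↦]-assoc (X₁ ⊴ α ⊵ X₂) Y Z U V =
    cong₂ (_⊴ α ⊵_) ([T↦,F↦]-assoc X₁ Y Z U V) ([T↦,F↦]-assoc X₂ Y Z U V)

  replace-cong : ∀ {X X′ Y Y′ Z Z′ : Tree A} → X ≡ X′ → Y ≡ Y′ → Z ≡ Z′ →
    X [T↦ Y ,F↦ Z ] ≡ X′ [T↦ Y′ ,F↦ Z′ ]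
  replace-cong refl refl refl = refl

  eval : ∀ {v} {V : Set v} → (V → Tree A) → Term A V → Tree A
  eval ρ (var x)     = ρ x
  eval ρ T           = T
  eval ρ F           = F
  eval ρ (atom α)    = T ⊴ α ⊵ F
  eval ρ (p ◁ q ▷ r) = eval ρ q [T↦ eval ρ p ,F↦ eval ρ r ]

  eval-⟪⟫ : ∀ {v w} {V : Set v} {W : Set w} (ρ : W → Tree A) (σ : V → Term A W) t →
    eval ρ (t ⟪ σ ⟫) ≡ eval (eval ρ ∘ σ) t
  eval-⟪⟫ ρ σ (var x)     = refl
  eval-⟪⟫ ρ σ T           = refl
  eval-⟪⟫ ρ σ F           = refl
  eval-⟪⟫ ρ σ (atom α)    = refl
  eval-⟪⟫ ρ σ (p ◁ q ▷ r) =
    replace-cong (eval-⟪⟫ ρ σ q) (eval-⟪⟫ ρ σ p) (eval-⟪⟫ ρ σ r)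

  eval-⌜⌝ : ∀ (ρ : ℕ → Tree A) P → eval ρ ⌜ P ⌝ ≡ se P
  eval-⌜⌝ ρ T           = refl
  eval-⌜⌝ ρ F           = refl
  eval-⌜⌝ ρ (atom α)    = refl
  eval-⌜⌝ ρ (P ◁ Q ▷ R) = replace-cong (eval-⌜⌝ ρ Q) (eval-⌜⌝ ρ P) (eval-⌜⌝ ρ R)

  -- The valuation is quantified after the derivation because the substitution rule needs the
  -- induction hypothesis at `eval ρ ∘ σ`.
  eval-sound : ∀ {s t : Term A ℕ} → CP ⊢ s ≈ t → ∀ ρ → eval ρ s ≡ eval ρ t
  eval-sound (axiom CP1)        ρ = refl
  eval-sound (axiom CP2)        ρ = refl
  eval-sound (axiom CP3)        ρ = [T↦T,F↦F]-identity (ρ 0)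
  -- Variable 2 is the innermost condition of CP4, so its tree is the one grafted onto.
  eval-sound (axiom CP4)        ρ = [T↦,F↦]-assoc (ρ 2) (ρ 1) (ρ 3) (ρ 0) (ρ 4)
  eval-sound reflexivity        ρ = refl
  eval-sound (symmetry d)       ρ = sym (eval-sound d ρ)
  eval-sound (transitivity d e) ρ = trans (eval-sound d ρ) (eval-sound e ρ)
  eval-sound (congruence d e f) ρ =
    replace-cong (eval-sound e ρ) (eval-sound d ρ) (eval-sound f ρ)
  eval-sound (substitution {s} {t} σ d) ρ = begin
    eval ρ (s ⟪ σ ⟫)    ≡⟨ eval-⟪⟫ ρ σ s ⟩
    eval (eval ρ ∘ σ) s ≡⟨ eval-sound d (eval ρ ∘ σ) ⟩
    eval (eval ρ ∘ σ) t ≡⟨ eval-⟪⟫ ρ σ t ⟨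
    eval ρ (t ⟪ σ ⟫)    ∎
    where open ≡-Reasoning

  se-sound : ∀ (P Q : C A) → CP ⊢ P ≈ᶜ Q → P =se Q
  se-sound P Q d = begin
    se P              ≡⟨ eval-⌜⌝ ρ P ⟨
    eval ρ ⌜ P ⌝      ≡⟨ eval-sound d ρ ⟩
    eval ρ ⌜ Q ⌝      ≡⟨ eval-⌜⌝ ρ Q ⟩
    se Q              ∎
    where
    open ≡-Reasoning
    -- Closed terms contain no variables, so any valuation would do.
    ρ : ℕ → Tree A
    ρ _ = T

  -- Follows the variable numbering of `CP`; the last clause also absorbs every index above 4.
  assign : (x y z u v : Term A ℕ) → ℕ → Term A ℕ
  assign x y z u v 0 = x
  assign x y z u v 1 = y
  assign x y z u v 2 = z
  assign x y z u v 3 = u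
  assign x y z u v (suc (suc (suc (suc _)))) = v

  cp1 : ∀ x y → CP ⊢ x ◁ T ▷ y ≈ x
  cp1 x y = substitution (assign x y T T T) (axiom CP1)

  cp2 : ∀ x y → CP ⊢ x ◁ F ▷ y ≈ y
  cp2 x y = substitution (assign x y T T T) (axiom CP2)

  cp3 : ∀ x → CP ⊢ T ◁ x ▷ F ≈ x
  cp3 x = substitution (assign x T T T T) (axiom CP3)

  cp4 : ∀ x y z u v → CP ⊢ x ◁ (y ◁ z ▷ u) ▷ v ≈ (x ◁ y ▷ v) ◁ z ▷ (x ◁ u ▷ v)
  cp4 x y z u v = substitution (assign x y z u v) (axiom CP4)

  normalForm : Tree A → Term A ℕ
  normalForm T           = T
  normalForm F           = F
  normalForm (X ⊴ α ⊵ Y) = normalForm X ◁ atom α ▷ normalForm Y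

  -- CP1 and CP2 settle the leaves of `X`. At a node, CP4 moves the outer conditional into both
  -- branches and leaves an atom as the condition.
  normalForm-replace : ∀ X Y Z →
    CP ⊢ normalForm Y ◁ normalForm X ▷ normalForm Z ≈ normalForm (X [T↦ Y ,F↦ Z ])
  normalForm-replace T             Y Z = cp1 (normalForm Y) (normalForm Z)
  normalForm-replace F             Y Z = cp2 (normalForm Y) (normalForm Z)
  normalForm-replace (X₁ ⊴ α ⊵ X₂) Y Z = transitivity
    (cp4 (normalForm Y) (normalForm X₁) (atom α) (normalForm X₂) (normalForm Z))
    (congruence (normalForm-replace X₁ Y Z) reflexivity (normalForm-replace X₂ Y Z))

  ⌜⌝≈normalForm : ∀ (P : C A) → CP ⊢ ⌜ P ⌝ ≈ normalForm (se P)
  ⌜⌝≈normalForm T           = reflexivity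
  ⌜⌝≈normalForm F           = reflexivity
  -- CP3 from right to left expands the atom to `T ◁ atom α ▷ F`.
  ⌜⌝≈normalForm (atom α)    = symmetry (cp3 (atom α))
  ⌜⌝≈normalForm (P ◁ Q ▷ R) = transitivity
    (congruence (⌜⌝≈normalForm P) (⌜⌝≈normalForm Q) (⌜⌝≈normalForm R))
    (normalForm-replace (se Q) (se P) (se R))

  se-complete : ∀ (P Q : C A) → P =se Q → CP ⊢ P ≈ᶜ Q
  se-complete P Q eq = transitivity (⌜⌝≈normalForm P) nfP≈Q
    where
    nfP≈Q : CP ⊢ normalForm (se P) ≈ ⌜ Q ⌝
    -- Equal trees have the same normal form, which links the two terms.
    nfP≈Q rewrite eq = symmetry (⌜⌝≈normalForm Q)

theorem2p11 : ∀ {ℓ} (A : Set ℓ) → A ↣ ℕ → (∃₂ λ (a b : A) → a ≢ b) →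
    ∀ (P Q : C A) → (CP ⊢ P ≈ᶜ Q) ⇔ (P =se Q)
theorem2p11 A _ _ P Q = mk⇔ (se-sound P Q) (se-complete P Q)
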